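{- Let $n\ge1$ and let $S=\{s_1,\dots,s_k\}$ with $1\le s_1<\dots<s_k<n$. Then $$\kappa_n(S)=\prod_{r=1}^{k+1} r^{\,s_r-s_{r-1}},$$ where $s_0=0$ and $s_{k+1}=n$.
   Context: $\mathcal{S}_n$ is the set of permutations of $[n]=\{1,\dots,n\}$, written as words $\pi=a_1\cdots a_n$. The set of ascent bottoms is $A(\pi)=\{a_i : i\in[n-1],\ a_i<a_{i+1}\}$, and $\kappa_n(S)=|\{\pi\in\mathcal{S}_n : A(\pi)\subseteq S\}|$. -}

module Defs where

open import Data.Bool.Base using (if_then_else_)
open import Data.Fin.Base using (toℕ; inject₁) renaming (suc to fsuc)
open import Data.List.Base
  using (List; []; _∷_; applyUpTo; cartesianProductWith; filter; length; tabulate)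
open import Data.List.Relation.Binary.Subset.DecPropositional using (_⊆?_)
open import Data.List.Relation.Unary.Unique.DecPropositional using (unique?)
open import Data.Nat.Base using (ℕ; zero; suc; _∸_; _^_)
open import Data.Nat.ListAction using (product)
open import Data.Nat.Properties using (_≟_; _<?_)
open import Data.Vec.Base using (Vec; lookup; _∷ʳ_) renaming (_∷_ to _∷ᵛ_)
open import Relation.Nullary.Decidable.Core using (does)

[1⋯_] : ℕ → List ℕ
[1⋯ n ] = applyUpTo suc n

words : List ℕ → ℕ → List (List ℕ)
words alphabet zero    = [] ∷ []
words alphabet (suc m) = cartesianProductWith _∷_ alphabet (words alphabet m)

-- The permutations of [n] are the words of length n over [n] without
-- repeated letters; each occurs exactly once in this list.
𝒮 : ℕ → List (List ℕ)
𝒮 n = filter (unique? _≟_) (words [1⋯ n ] n)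

ascentBottoms : List ℕ → List ℕ
ascentBottoms []          = []
ascentBottoms (a ∷ [])    = []
ascentBottoms (a ∷ b ∷ π) =
  if does (a <? b) then a ∷ ascentBottoms (b ∷ π) else ascentBottoms (b ∷ π)

-- A finite set S of naturals is given by a list of its elements; only
-- membership in that list matters.
κ : ℕ → List ℕ → ℕ
κ n S = length (filter (λ π → _⊆?_ _≟_ (ascentBottoms π) S) (𝒮 n))

-- The sequence s₀ = 0 , s₁ , … , sₖ , sₖ₊₁ = n.
extend : ∀ {k} → ℕ → Vec ℕ k → Vec ℕ (suc (suc k))
extend n s = 0 ∷ᵛ (s ∷ʳ n)

-- The index i : Fin (k + 1) stands for r = i + 1, so that fsuc i and
-- inject₁ i are the positions of s_r and s_{r-1}.  The subtraction never
-- truncates when the extended sequence is increasing.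
gapProduct : ∀ {k} → ℕ → Vec ℕ k → ℕ
gapProduct n s = product (tabulate λ i →
  suc (toℕ i) ^ (lookup (extend n s) (fsuc i) ∸ lookup (extend n s) (inject₁ i)))

{-# OPTIONS --safe #-}

-- Inserting a letter larger than all letters of π at the front leaves A(π)
-- unchanged, and inserting it right after a letter a turns A(π) into
-- A(π) ∪ {a}.  Hence κ_{n+1}(S) = κ_n(S) · (1 + |S ∩ [n]|), and for
-- s_{r-1} ≤ n < s_r the factor is r.
module Submission where

open import Defs
open import Data.Fin.Base using (toℕ; inject₁) renaming (suc to fsuc)
open import Data.List.Base
  using (List; []; _∷_; [_]; _++_; applyDownFrom; concatMap; filter; length; map; tabulate)
open import Data.List.Membership.DecPropositional using (_∈?_)
open import Data.List.Membership.Propositional using (_∈_; _∉_; find)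
open import Data.List.Membership.Propositional.Properties
open import Data.List.Membership.Propositional.Properties.WithK using (unique∧set⇒bag)
open import Data.List.Properties
  using (++-identityʳ; filter-accept; filter-all; filter-none; filter-reject; filter-++; filter-≐;
         length-++; length-applyUpTo; map-∘; reverse-applyUpTo; tabulate-cong)
open import Data.List.Relation.Binary.BagAndSetEquality using (∼bag⇒↭)
open import Data.List.Relation.Binary.Disjoint.Propositional using (Disjoint)
open import Data.List.Relation.Binary.Permutation.Propositional
  using (_↭_; ↭-refl; ↭-sym; ↭-trans; ↭-prep; ↭-swap; ↭⇒↭ₛ)
open import Data.List.Relation.Binary.Permutation.Propositional.Properties
  using (∈-resp-↭; All-resp-↭; ↭-empty-inv; ↭-length; ↭-reverse; drop-mid; filter-↭; shift;
         ++⁺ˡ)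
import Data.List.Relation.Binary.Permutation.Setoid.Properties as Permutationₛ
open import Data.List.Relation.Binary.Subset.Propositional using (_⊆_)
open import Data.List.Relation.Binary.Subset.Propositional.Properties using (∈-∷⁺ʳ)
open import Data.List.Relation.Binary.Subset.DecPropositional using (_⊆?_)
import Data.List.Relation.Unary.All as List
import Data.List.Relation.Unary.All.Properties as Listₚ
open import Data.List.Relation.Unary.AllPairs using (AllPairs; []; _∷_)
import Data.List.Relation.Unary.AllPairs.Properties as AllPairsₚ
open import Data.List.Relation.Unary.Any using (here; there)
open import Data.List.Relation.Unary.Unique.Propositional using (Unique)
open import Data.List.Relation.Unary.Unique.DecPropositional using (unique?)
import Data.List.Relation.Unary.Unique.Propositional.Properties as Unique
open import Data.Nat.Base
open import Data.Nat.ListAction using (product)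
open import Data.Nat.Properties
open import Data.Product.Base using (_×_; _,_; proj₁; proj₂; ∃-syntax)
open import Data.Sum.Base using (inj₁; inj₂)
open import Data.Vec.Base using (Vec; toList; lookup; _∷ʳ_; []; _∷_)
open import Data.Vec.Relation.Unary.All using (All; []; _∷_)
import Data.Vec.Relation.Unary.All.Properties as Allₚ
open import Data.Vec.Relation.Unary.Linked as Linked using (Linked; []; [-]; _∷_)
open import Data.Vec.Relation.Unary.Linked.Properties using (Linked⇒All)
open import Function.Base using (_∘_; id)
open import Function.Bundles using (_⇔_; mk⇔; Equivalence)
open import Level using (Level)
open import Relation.Binary.Definitions using (DecidableEquality)
open import Relation.Binary.PropositionalEquality
  using (_≡_; _≢_; refl; sym; trans; cong; cong₂; subst; setoid; module ≡-Reasoning)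
open import Relation.Nullary using (¬_; Dec; yes; no; contradiction; ¬?)
open import Relation.Nullary.Decidable using (dec-true; dec-false)
open import Relation.Unary using (Pred; Decidable)

open Equivalence using (to; from)

private
  variable
    a b p q : Level
    A : Set a
    B : Set b
    x y : A
    xs ys π σ : List A

-- Counting

module _ {P : Pred A p} (P? : Decidable P) where

  count : List A → ℕ
  count = length ∘ filter P?

  count-accept : ∀ x xs → P x → count (x ∷ xs) ≡ suc (count xs)
  count-accept x xs = cong length ∘ filter-accept P?

  count-reject : ∀ x xs → ¬ P x → count (x ∷ xs) ≡ count xs
  count-reject x xs = cong length ∘ filter-reject P?

  count-none : (∀ {x} → x ∈ xs → ¬ P x) → count xs ≡ 0
  count-none = cong length ∘ filter-none P? ∘ List.tabulate

  count-++ : ∀ xs ys → count (xs ++ ys) ≡ count xs + count ys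
  count-++ xs ys = trans (cong length (filter-++ P? xs ys)) (length-++ (filter P? xs))

  count-↭ : xs ↭ ys → count xs ≡ count ys
  count-↭ = ↭-length ∘ filter-↭ P?

count-∷-cong : {P : Pred A p} (P? : Decidable P) {Q : Pred B q} (Q? : Decidable Q) →
               ∀ x xs y ys → P x ⇔ Q y → count P? xs ≡ count Q? ys →
               count P? (x ∷ xs) ≡ count Q? (y ∷ ys)
count-∷-cong P? Q? x xs y ys eqv eq with P? x
... | yes px = trans (cong suc eq) (sym (count-accept Q? y ys (to eqv px)))
... | no ¬px = trans eq (sym (count-reject Q? y ys (¬px ∘ from eqv)))

count-map-cong : {P : Pred B p} (P? : Decidable P) {f g : A → B} →
                 (∀ x → P (f x) ⇔ P (g x)) →
                 ∀ xs → count P? (map f xs) ≡ count P? (map g xs)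
count-map-cong P? eqv []       = refl
count-map-cong P? eqv (x ∷ xs) = count-∷-cong P? P? _ _ _ _ (eqv x) (count-map-cong P? eqv xs)

-- The counting shape of the recursion: with `f` inserting a new largest letter, each good word
-- yields `k` good words and each bad word yields none.
count-concatMap : {P : Pred A p} (P? : Decidable P) {Q : Pred B q} (Q? : Decidable Q) →
                  ∀ (f : A → List B) k xs →
                  (∀ {x} → x ∈ xs → P x → count Q? (f x) ≡ k) →
                  (∀ {x} → x ∈ xs → ¬ P x → count Q? (f x) ≡ 0) →
                  count Q? (concatMap f xs) ≡ count P? xs * k
count-concatMap P? Q? f k []       _   _  = refl
count-concatMap P? Q? f k (x ∷ xs) acc rej
  with ih ← count-concatMap P? Q? f k xs (acc ∘ there) (rej ∘ there) | P? x
... | yes px = trans (count-++ Q? (f x) _) (cong₂ _+_ (acc (here refl) px) ih)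
... | no ¬px = trans (count-++ Q? (f x) _) (cong₂ _+_ (rej (here refl) ¬px) ih)

-- Duplicate-free lists

Unique-resp-↭ : xs ↭ ys → Unique xs → Unique ys
Unique-resp-↭ = Permutationₛ.Unique-resp-↭ (setoid _) ∘ ↭⇒↭ₛ

unique∧set⇒↭ : Unique xs → Unique ys → xs ⊆ ys → ys ⊆ xs → xs ↭ ys
unique∧set⇒↭ xs! ys! xs⊆ys ys⊆xs = ∼bag⇒↭ (unique∧set⇒bag xs! ys! (mk⇔ xs⊆ys ys⊆xs))

-- The complement `zs` is found by induction. The head lies in the tail or in the tail's complement;
-- uniqueness excludes the former, so it can be pulled out of the complement to the front.
unique∧⊆⇒↭++ : Unique xs → xs ⊆ ys → ∃[ zs ] ys ↭ xs ++ zs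
unique∧⊆⇒↭++ {ys = ys} [] _ = ys , ↭-refl
unique∧⊆⇒↭++ {xs = x ∷ xs} xs!@(_ ∷ xs!′) xs⊆ys
  with zs , ys↭ ← unique∧⊆⇒↭++ xs!′ (xs⊆ys ∘ there)
  with ∈-++⁻ xs (∈-resp-↭ ys↭ (xs⊆ys (here refl)))
... | inj₁ x∈xs = contradiction x∈xs (Unique.Unique[x∷xs]⇒x∉xs xs!)
... | inj₂ x∈zs with us , vs , refl ← ∈-∃++ x∈zs =
  us ++ vs , ↭-trans ys↭ (↭-trans (++⁺ˡ xs (shift x us vs)) (shift x xs (us ++ vs)))

-- Pigeonhole: equal lengths force the complement of `xs` in `ys` to be empty.
unique∧⊆∧length⇒↭ : Unique xs → xs ⊆ ys → length xs ≡ length ys → xs ↭ ys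
unique∧⊆∧length⇒↭ {xs = xs} xs! xs⊆ys eq with unique∧⊆⇒↭++ xs! xs⊆ys
... | []     , ys↭ = ↭-sym (subst (_ ↭_) (++-identityʳ xs) ys↭)
... | z ∷ zs , ys↭ = contradiction
  (trans eq (trans (↭-length ys↭) (length-++ xs))) (m≢1+m+n _ ∘ λ e → trans e (+-suc _ _))

-- In its use below, `P` says that the new letter is absent from a word; this turns distinctness of
-- words into disjointness of their lists of insertions.
AllPairs-strengthen : {P : Pred A p} {R S : A → A → Set q} →
                      (∀ {x y} → P x → P y → R x y → S x y) →
                      List.All P xs → AllPairs R xs → AllPairs S xs
AllPairs-strengthen f List.[]         []         = []
AllPairs-strengthen f (px List.∷ pxs) (rs ∷ rss) =
  List.zipWith (λ (py , r) → f px py r) (pxs , rs) ∷ AllPairs-strengthen f pxs rss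

-- Permutations by successive insertion

insertions : A → List A → List (List A)
insertions x []       = [ [ x ] ]
insertions x (y ∷ ys) = (x ∷ y ∷ ys) ∷ map (y ∷_) (insertions x ys)

permutations : List A → List (List A)
permutations []       = [ [] ]
permutations (x ∷ xs) = concatMap (insertions x) (permutations xs)

∈-insertions⇒↭ : ∀ π → σ ∈ insertions x π → σ ↭ x ∷ π
∈-insertions⇒↭ []      (here refl) = ↭-refl
∈-insertions⇒↭ (y ∷ π) (here refl) = ↭-refl
∈-insertions⇒↭ (y ∷ π) (there σ∈) with τ , τ∈ , refl ← ∈-map⁻ (y ∷_) σ∈ =
  ↭-trans (↭-prep y (∈-insertions⇒↭ π τ∈)) (↭-swap y _ ↭-refl)

∈-insertions⁺ : ∀ (x : A) xs ys → xs ++ [ x ] ++ ys ∈ insertions x (xs ++ ys)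
∈-insertions⁺ x []       []       = here refl
∈-insertions⁺ x []       (y ∷ ys) = here refl
∈-insertions⁺ x (z ∷ xs) ys       = there (∈-map⁺ (z ∷_) (∈-insertions⁺ x xs ys))

∈-permutations⁻ : ∀ xs → π ∈ permutations xs → π ↭ xs
∈-permutations⁻ []       (here refl) = ↭-refl
∈-permutations⁻ (x ∷ xs) π∈
  with σ , σ∈ , π∈σ ← find (∈-concatMap⁻ (insertions x) {xs = permutations xs} π∈) =
  ↭-trans (∈-insertions⇒↭ σ π∈σ) (↭-prep x (∈-permutations⁻ xs σ∈))

-- Splitting `π` around an occurrence of `x` exhibits it as an insertion of `x` into `us ++ vs`,
-- which is a rearrangement of the tail.
∈-permutations⁺ : ∀ xs → π ↭ xs → π ∈ permutations xs
∈-permutations⁺ []       π↭ = here (↭-empty-inv π↭)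
∈-permutations⁺ (x ∷ xs) π↭
  with us , vs , refl ← ∈-∃++ (∈-resp-↭ (↭-sym π↭) (here refl)) =
  ∈-concat⁺′ (∈-insertions⁺ x us vs)
    (∈-map⁺ (insertions x) (∈-permutations⁺ xs (drop-mid us [] π↭)))

-- Only the insertion at the front begins with `x`: all others begin with `y`, which differs from
-- `x`.
insertions-unique : ∀ π → x ∉ π → Unique (insertions x π)
insertions-unique []      _  = List.[] ∷ []
insertions-unique (y ∷ π) x∉ =
  Listₚ.map⁺ (List.universal (λ { _ refl → x∉ (here refl) }) _) ∷
  Unique.map⁺ (λ { refl → refl }) (insertions-unique π (x∉ ∘ there))

module _ {A : Set a} (_≟ᴬ_ : DecidableEquality A) where

  private
    _≢?_ : (y x : A) → Dec (y ≢ x)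
    y ≢? x = ¬? (y ≟ᴬ x)

    delete : A → List A → List A
    delete x = filter (_≢? x)

    delete-∉ : x ∉ π → delete x π ≡ π
    delete-∉ x∉ = filter-all (_≢? _) (List.tabulate λ { y∈ refl → x∉ y∈ })

    delete-insertion : ∀ π → x ∉ π → σ ∈ insertions x π → delete x σ ≡ π
    delete-insertion []      x∉ (here refl) = filter-reject (_≢? _) (λ ≢ → ≢ refl)
    delete-insertion (y ∷ π) x∉ (here refl) =
      trans (filter-reject (_≢? _) (λ ≢ → ≢ refl)) (delete-∉ x∉)
    delete-insertion (y ∷ π) x∉ (there σ∈) with τ , τ∈ , refl ← ∈-map⁻ (y ∷_) σ∈ =
      trans (filter-accept (_≢? _) (λ { refl → x∉ (here refl) }))
            (cong (y ∷_) (delete-insertion π (x∉ ∘ there) τ∈))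

  -- Deleting `x` undoes every insertion of `x`, so a common element would determine both words and
  -- make them equal.
  insertions-disjoint : ∀ {x : A} {π σ} → x ∉ π → x ∉ σ → π ≢ σ →
                        Disjoint (insertions x π) (insertions x σ)
  insertions-disjoint x∉π x∉σ π≢σ (∈π , ∈σ) =
    π≢σ (trans (sym (delete-insertion _ x∉π ∈π)) (delete-insertion _ x∉σ ∈σ))

  permutations-unique : ∀ {xs : List A} → Unique xs → Unique (permutations xs)
  permutations-unique []                                     = List.[] ∷ []
  permutations-unique {xs = x ∷ xs} x∷xs!@(_ ∷ xs!) = Unique.concat⁺
    (Listₚ.map⁺ (List.map (insertions-unique _) x∉))
    (AllPairsₚ.map⁺ (AllPairs-strengthen insertions-disjoint x∉ (permutations-unique xs!)))
    where
    x∉ : List.All (x ∉_) (permutations xs)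
    x∉ = List.tabulate λ π∈ →
      Unique.Unique[x∷xs]⇒x∉xs x∷xs! ∘ ∈-resp-↭ (∈-permutations⁻ xs π∈)

-- The list `𝒮 n` as the permutations generated by insertion

∈-words⁻ : ∀ Γ m → π ∈ words Γ m → length π ≡ m × π ⊆ Γ
∈-words⁻ Γ zero    (here refl) = refl , λ ()
∈-words⁻ Γ (suc m) π∈
  with c , ρ , c∈ , ρ∈ , refl ← ∈-cartesianProductWith⁻ _∷_ Γ (words Γ m) π∈
  with eq , ρ⊆ ← ∈-words⁻ Γ m ρ∈ = cong suc eq , ∈-∷⁺ʳ c∈ ρ⊆

∈-words⁺ : ∀ Γ π → π ⊆ Γ → π ∈ words Γ (length π)
∈-words⁺ Γ []      _  = here refl
∈-words⁺ Γ (c ∷ π) π⊆ =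
  ∈-cartesianProductWith⁺ _∷_ (π⊆ (here refl)) (∈-words⁺ Γ π (π⊆ ∘ there))

words-unique : ∀ {Γ} → Unique Γ → ∀ m → Unique (words Γ m)
words-unique Γ! zero    = List.[] ∷ []
words-unique Γ! (suc m) =
  Unique.cartesianProductWith⁺ _∷_ (λ { refl → refl , refl }) Γ! (words-unique Γ! m)

-- Listed in decreasing order so that `permutations` treats the largest letter as the head and
-- inserts it last, into the permutations of the smaller letters.
[n⋯1] : ℕ → List ℕ
[n⋯1] = applyDownFrom suc

∈-[n⋯1]⁺ : ∀ {v n} → 1 ≤ v → v ≤ n → v ∈ [n⋯1] n
∈-[n⋯1]⁺ {suc v} _ v<n = ∈-applyDownFrom⁺ suc v<n

[1⋯n]↭[n⋯1] : ∀ n → [1⋯ n ] ↭ [n⋯1] n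
[1⋯n]↭[n⋯1] n = ↭-sym (subst (_↭ [1⋯ n ]) (reverse-applyUpTo suc n) (↭-reverse [1⋯ n ]))

[1⋯n]-unique : ∀ n → Unique [1⋯ n ]
[1⋯n]-unique n = Unique.applyUpTo⁺₁ suc n λ i<j _ → <⇒≢ i<j ∘ suc-injective

[n⋯1]-unique : ∀ n → Unique ([n⋯1] n)
[n⋯1]-unique n = Unique-resp-↭ ([1⋯n]↭[n⋯1] n) ([1⋯n]-unique n)

-- Both lists are free of repetitions, so it suffices that they have the same elements.
𝒮↭permutations : ∀ n → 𝒮 n ↭ permutations ([n⋯1] n)
𝒮↭permutations n = unique∧set⇒↭
  (Unique.filter⁺ (unique? _≟_) (words-unique ([1⋯n]-unique n) n))
  (permutations-unique _≟_ ([n⋯1]-unique n))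
  𝒮⊆ ⊆𝒮
  where
  𝒮⊆ : 𝒮 n ⊆ permutations ([n⋯1] n)
  𝒮⊆ π∈ with π∈w , π! ← ∈-filter⁻ (unique? _≟_) {xs = words [1⋯ n ] n} π∈
        with len , π⊆ ← ∈-words⁻ [1⋯ n ] n π∈w =
    ∈-permutations⁺ _ (↭-trans
      -- A repetition-free word of length `n` over `n` letters uses every letter.
      (unique∧⊆∧length⇒↭ π! π⊆ (trans len (sym (length-applyUpTo suc n))))
      ([1⋯n]↭[n⋯1] n))

  ⊆𝒮 : permutations ([n⋯1] n) ⊆ 𝒮 n
  ⊆𝒮 {π} π∈ = ∈-filter⁺ (unique? _≟_)
    (subst (λ m → π ∈ words [1⋯ n ] m) (trans (↭-length π↭) (length-applyUpTo suc n))
      (∈-words⁺ [1⋯ n ] π (∈-resp-↭ π↭)))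
    (Unique-resp-↭ (↭-sym π↭) ([1⋯n]-unique n))
    where
    π↭ : π ↭ [1⋯ n ]
    π↭ = ↭-trans (∈-permutations⁻ _ π∈) (↭-sym ([1⋯n]↭[n⋯1] n))

-- The recursion for κ

module _ (S : List ℕ) where

  -- The condition that A(π) is contained in `S`, as an `All`, so that a leading ascent bottom can
  -- be split off.
  Good : List ℕ → Set
  Good π = List.All (_∈ S) (ascentBottoms π)

  ∈S? : Decidable (_∈ S)
  ∈S? v = _∈?_ _≟_ v S

  Good? : Decidable Good
  Good? π = List.all? ∈S? (ascentBottoms π)

  -- The comparison of `a` with `b` alone decides whether `a` is an ascent bottom; the inductions
  -- below peel off one letter at a time with this equivalence.
  Good-∷∷ : ∀ a b π → Good (a ∷ b ∷ π) ⇔ ((a < b → a ∈ S) × Good (b ∷ π))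
  Good-∷∷ a b π with a <? b
  -- The rewrite settles the Boolean on which `ascentBottoms` branches.
  ... | yes a<b rewrite dec-true (a <? b) a<b = mk⇔
    (λ { (a∈ List.∷ good) → (λ _ → a∈) , good })
    (λ (a∈ , good) → a∈ a<b List.∷ good)
  ... | no a≮b rewrite dec-false (a <? b) a≮b = mk⇔
    (λ good → (λ a<b → contradiction a<b a≮b) , good)
    proj₂

  -- A largest letter in front is followed by a descent or by nothing, so it is no ascent bottom.
  Good-max∷ : ∀ x π → List.All (_< x) π → Good (x ∷ π) ⇔ Good π
  Good-max∷ x [] List.[]          = mk⇔ id id
  Good-max∷ x (y ∷ π) (y<x List.∷ _) = mk⇔
    (proj₂ ∘ to (Good-∷∷ x y π))
    (λ good → from (Good-∷∷ x y π) ((λ x<y → contradiction x<y (<-asym y<x)) , good))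

  -- Inserting a largest letter never destroys an ascent bottom. The letter `y` is kept in front
  -- because an insertion at the head of `π` changes the right neighbour of `y`.
  Good-insertion⁻ : ∀ {x} y → List.All (_< x) (y ∷ π) → σ ∈ insertions x π →
                    Good (y ∷ σ) → Good (y ∷ π)
  Good-insertion⁻ {π = []}     y _ _ _ = List.[]
  Good-insertion⁻ {π = z ∷ π} {x = x} y (y<x List.∷ π<x) (here refl) good
    -- Here `y` has become an ascent bottom, so `y ∈ S` holds whether or not `y < z`.
    with y∈ , good′ ← to (Good-∷∷ y x (z ∷ π)) good =
    from (Good-∷∷ y z π) ((λ _ → y∈ y<x) , to (Good-max∷ x (z ∷ π) π<x) good′)
  Good-insertion⁻ {π = z ∷ π} y (y<x List.∷ π<x) (there σ∈) good
    with τ , τ∈ , refl ← ∈-map⁻ (z ∷_) σ∈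
    with y∈ , good′ ← to (Good-∷∷ y z τ) good =
    from (Good-∷∷ y z π) (y∈ , Good-insertion⁻ z π<x τ∈ good′)

  -- The places for `x` are matched with the letters they directly follow: inserting `x` after a
  -- letter makes that letter an ascent bottom and leaves the others as they were, so the result is
  -- good exactly when the letter lies in `S`.
  count-Good-∷insertions : ∀ {x} y π → List.All (_< x) (y ∷ π) → Good (y ∷ π) →
    count Good? (map (y ∷_) (insertions x π)) ≡ count ∈S? (y ∷ π)
  count-Good-∷insertions {x} y [] (y<x List.∷ _) good =
    count-∷-cong Good? ∈S? (y ∷ x ∷ []) [] y [] (mk⇔
      (λ good′ → proj₁ (to (Good-∷∷ y x []) good′) y<x)
      (λ y∈ → from (Good-∷∷ y x []) ((λ _ → y∈) , List.[]))) refl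
  count-Good-∷insertions {x} y (z ∷ π) (y<x List.∷ π<x) good
    with y∈ , good′ ← to (Good-∷∷ y z π) good =
    count-∷-cong Good? ∈S? (y ∷ x ∷ z ∷ π) _ y (z ∷ π) (mk⇔
      (λ good″ → proj₁ (to (Good-∷∷ y x (z ∷ π)) good″) y<x)
      (λ y∈′ → from (Good-∷∷ y x (z ∷ π)) ((λ _ → y∈′) , from (Good-max∷ x (z ∷ π) π<x) good′)))
    (begin
      count Good? (map (y ∷_) (map (z ∷_) (insertions x π)))
        ≡⟨ cong (count Good?) (map-∘ (insertions x π)) ⟨
      count Good? (map (λ τ → y ∷ z ∷ τ) (insertions x π))
        ≡⟨ count-map-cong Good? (λ τ → mk⇔ (proj₂ ∘ to (Good-∷∷ y z τ))
             (λ g → from (Good-∷∷ y z τ) (y∈ , g))) (insertions x π) ⟩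
      count Good? (map (z ∷_) (insertions x π))
        ≡⟨ count-Good-∷insertions z π π<x good′ ⟩
      count ∈S? (z ∷ π) ∎)
    where open ≡-Reasoning

  -- The extra one is the insertion at the front, which is always good.
  count-Good-insertions : ∀ {x} π → List.All (_< x) π → Good π →
    count Good? (insertions x π) ≡ suc (count ∈S? π)
  count-Good-insertions {x} []      _   _    = count-accept Good? (x ∷ []) [] List.[]
  count-Good-insertions {x} (y ∷ π) π<x good =
    trans (count-accept Good? (x ∷ y ∷ π) (map (y ∷_) (insertions x π))
            (from (Good-max∷ x (y ∷ π) π<x) good))
          (cong suc (count-Good-∷insertions y π π<x good))

  count-¬Good-insertions : ∀ {x} π → List.All (_< x) π → ¬ Good π →
    count Good? (insertions x π) ≡ 0
  count-¬Good-insertions []      _   ¬good = contradiction List.[] ¬good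
  count-¬Good-insertions (y ∷ π) π<x ¬good = count-none Good? bad
    where
    bad : ∀ {σ} → σ ∈ insertions _ (y ∷ π) → ¬ Good σ
    bad (here refl) good = ¬good (to (Good-max∷ _ (y ∷ π) π<x) good)
    bad (there σ∈)  good with τ , τ∈ , refl ← ∈-map⁻ (y ∷_) σ∈ =
      ¬good (Good-insertion⁻ y π<x τ∈ good)

  κ≡count : ∀ n → κ n S ≡ count Good? (permutations ([n⋯1] n))
  κ≡count n = trans
    (cong length (filter-≐ (λ π → _⊆?_ _≟_ (ascentBottoms π) S) Good?
      ((λ A⊆S → List.tabulate A⊆S) , λ good → List.lookup good) (𝒮 n)))
    (count-↭ Good? (𝒮↭permutations n))

  κ-suc : ∀ n → κ (suc n) S ≡ κ n S * suc (count ∈S? ([n⋯1] n))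
  κ-suc n = begin
    κ (suc n) S
      ≡⟨ κ≡count (suc n) ⟩
    count Good? (permutations ([n⋯1] (suc n)))
      ≡⟨ count-concatMap Good? Good? (insertions (suc n)) (suc (count ∈S? ([n⋯1] n)))
           (permutations ([n⋯1] n))
           (λ π∈ good → trans (count-Good-insertions _ (bounded π∈) good)
                              -- The number of letters in `S` is the same for every arrangement of
                              -- [n], which gives a constant factor.
                              (cong suc (count-↭ ∈S? (∈-permutations⁻ ([n⋯1] n) π∈))))
           (λ π∈ → count-¬Good-insertions _ (bounded π∈)) ⟩
    count Good? (permutations ([n⋯1] n)) * suc (count ∈S? ([n⋯1] n))
      ≡⟨ cong (_* suc (count ∈S? ([n⋯1] n))) (κ≡count n) ⟨
    κ n S * suc (count ∈S? ([n⋯1] n)) ∎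
    where
    open ≡-Reasoning
    bounded : π ∈ permutations ([n⋯1] n) → List.All (_< suc n) π
    bounded π∈ = All-resp-↭ (↭-sym (∈-permutations⁻ ([n⋯1] n) π∈)) (Listₚ.applyDownFrom⁺₁ suc n s<s)

  -- Both sides count the elements of `S` in [n], once by running through [n] and once by running
  -- through `S`; the latter is faithful because `S` has no repetitions and omits 0.
  count-[n⋯1] : Unique S → List.All (1 ≤_) S → ∀ n →
    count ∈S? ([n⋯1] n) ≡ count (_≤? n) S
  count-[n⋯1] S! 1≤S n = ↭-length (unique∧set⇒↭
    (Unique.filter⁺ ∈S? ([n⋯1]-unique n)) (Unique.filter⁺ (_≤? n) S!) forth back)
    where
    forth : filter ∈S? ([n⋯1] n) ⊆ filter (_≤? n) S
    forth v∈ with v∈n , v∈S ← ∈-filter⁻ ∈S? {xs = [n⋯1] n} v∈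
              with i , i<n , refl ← ∈-applyDownFrom⁻ suc v∈n = ∈-filter⁺ (_≤? n) v∈S i<n

    back : filter (_≤? n) S ⊆ filter ∈S? ([n⋯1] n)
    back v∈ with v∈S , v≤n ← ∈-filter⁻ (_≤? n) {xs = S} v∈ =
      ∈-filter⁺ ∈S? (∈-[n⋯1]⁺ (List.lookup 1≤S v∈S) v≤n) v∈S

-- Telescoping

-- Unfolds to gapProduct n s when r = a = 0.
gapProductFrom : ∀ {k} → ℕ → ℕ → ℕ → Vec ℕ k → ℕ
gapProductFrom r a n s = product (tabulate λ i →
  suc (r + toℕ i) ^ (lookup (a ∷ (s ∷ʳ n)) (fsuc i) ∸ lookup (a ∷ (s ∷ʳ n)) (inject₁ i)))

-- Splitting off the factor at index 0 shifts the remaining indices by one, and the shift is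
-- absorbed into the offset `suc r`.
gapProductFrom-∷ : ∀ {k} r a n b (s : Vec ℕ k) →
  gapProductFrom r a n (b ∷ s) ≡ suc r ^ (b ∸ a) * gapProductFrom (suc r) b n s
gapProductFrom-∷ r a n b s = cong₂ _*_
  (cong (λ m → suc m ^ (b ∸ a)) (+-identityʳ r))
  (cong product (tabulate-cong λ i →
    cong (λ m → suc m ^ (lookup (b ∷ (s ∷ʳ n)) (fsuc i) ∸ lookup (b ∷ (s ∷ʳ n)) (inject₁ i)))
      (+-suc r (toℕ i))))

module _ {f c : ℕ → ℕ} (f-suc : ∀ m → f (suc m) ≡ f m * suc (c m)) where

  -- Stated with an explicit distance `d`, on which the induction runs without truncated
  -- subtraction.
  constant-growth-+ : ∀ r a d → (∀ {m} → a ≤ m → m < a + d → c m ≡ r) →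
                      f (a + d) ≡ f a * suc r ^ d
  constant-growth-+ r a zero    _  = trans (cong f (+-identityʳ a)) (sym (*-identityʳ (f a)))
  constant-growth-+ r a (suc d) c≡ = begin
    f (a + suc d)                ≡⟨ cong f (+-suc a d) ⟩
    f (suc (a + d))              ≡⟨ f-suc (a + d) ⟩
    f (a + d) * suc (c (a + d))  ≡⟨ cong₂ _*_
      (constant-growth-+ r a d λ a≤m m< → c≡ a≤m (<-trans m< a+d<))
      (cong suc (c≡ (m≤m+n a d) a+d<)) ⟩
    f a * suc r ^ d * suc r      ≡⟨ *-assoc (f a) _ _ ⟩
    f a * (suc r ^ d * suc r)    ≡⟨ cong (f a *_) (*-comm _ (suc r)) ⟩
    f a * suc r ^ suc d          ∎
    where
    open ≡-Reasoning
    a+d< : a + d < a + suc d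
    a+d< = +-monoʳ-< a (n<1+n d)

  constant-growth : ∀ r {a b} → a ≤ b → (∀ {m} → a ≤ m → m < b → c m ≡ r) →
                    f b ≡ f a * suc r ^ (b ∸ a)
  constant-growth r {a} {b} a≤b c≡ = trans (cong f (sym (m+[n∸m]≡n a≤b)))
    (constant-growth-+ r a (b ∸ a) λ a≤m m< →
      c≡ a≤m (subst (_ <_) (m+[n∸m]≡n a≤b) m<))

  -- Here `r` is the number of entries already passed. Between `a` and the next entry `b` the count
  -- stays at `r`, giving the factor `suc r ^ (b ∸ a)`; from `b` on, `b` itself is counted, so the
  -- induction continues from `b` with `suc r`.
  growth : ∀ {k} r {a n} (s : Vec ℕ k) → a ≤ n →
           Linked _<_ (a ∷ s) → All (_< n) s →
           (∀ {m} → a ≤ m → c m ≡ r + count (_≤? m) (toList s)) →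
           f n ≡ f a * gapProductFrom r a n s
  growth r {a} {n} [] a≤n _ _ c≡ = begin
    f n                              ≡⟨ constant-growth r a≤n
      (λ a≤m _ → trans (c≡ a≤m) (+-identityʳ r)) ⟩
    f a * suc r ^ (n ∸ a)            ≡⟨ cong (f a *_) (*-identityʳ _) ⟨
    f a * (suc r ^ (n ∸ a) * 1)      ≡⟨ cong (λ m → f a * (suc m ^ (n ∸ a) * 1)) (+-identityʳ r) ⟨
    f a * gapProductFrom r a n []    ∎
    where open ≡-Reasoning
  growth r {a} {n} (b ∷ s) a≤n (a<b ∷ b∷s↗) (b<n ∷ s<n) c≡ = begin
    f n
      ≡⟨ growth (suc r) s (<⇒≤ b<n) b∷s↗ s<n (λ {m} b≤m →
           trans (c≡ (≤-trans (<⇒≤ a<b) b≤m))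
             (trans (cong (r +_) (count-accept (_≤? m) b (toList s) b≤m)) (+-suc r _))) ⟩
    f b * gapProductFrom (suc r) b n s
      ≡⟨ cong (_* gapProductFrom (suc r) b n s)
           (constant-growth r (<⇒≤ a<b) λ {m} a≤m m<b → trans (c≡ a≤m)
             -- All remaining entries are at least `b`, hence exceed `m`, and none is counted.
             (trans (cong (r +_) (count-none (_≤? m) λ v∈ →
               <⇒≱ (<-≤-trans m<b (List.lookup b≤ v∈)))) (+-identityʳ r))) ⟩
    f a * suc r ^ (b ∸ a) * gapProductFrom (suc r) b n s
      ≡⟨ *-assoc (f a) _ _ ⟩
    f a * (suc r ^ (b ∸ a) * gapProductFrom (suc r) b n s)
      ≡⟨ cong (f a *_) (gapProductFrom-∷ r a n b s) ⟨
    f a * gapProductFrom r a n (b ∷ s) ∎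
    where
    open ≡-Reasoning
    b≤ : List.All (b ≤_) (toList (b ∷ s))
    b≤ = Allₚ.toList⁺ (Linked⇒All ≤-trans ≤-refl (Linked.map <⇒≤ b∷s↗))

-- The product formula for increasing sequences

increasing⇒unique : ∀ {k} {s : Vec ℕ k} → Linked _<_ s → Unique (toList s)
increasing⇒unique []           = []
increasing⇒unique [-]          = List.[] ∷ []
increasing⇒unique (a<b ∷ b∷s↗) =
  List.map <⇒≢ (Allₚ.toList⁺ (Linked⇒All <-trans a<b b∷s↗)) ∷ increasing⇒unique b∷s↗

corollary7 : ∀ (n k : ℕ) (s : Vec ℕ k) → 1 ≤ n →
    All (1 ≤_) s → Linked _<_ s → All (_< n) s →
    κ n (toList s) ≡ gapProduct n s
corollary7 n k s _ 1≤s s↗ s<n = trans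
  (growth {f = λ m → κ m (toList s)} (κ-suc (toList s)) 0 s z≤n (0∷ 1≤s s↗) s<n
    (λ {m} _ → count-[n⋯1] (toList s) (increasing⇒unique s↗) (Allₚ.toList⁺ 1≤s) m))
  -- The initial value `κ 0 (toList s)` computes to 1: the empty word is the only permutation of the
  -- empty set, and it has no ascent bottoms.
  (*-identityˡ (gapProduct n s))
  where
  -- The positivity of the first entry makes 0 a valid starting point of the increasing chain.
  0∷ : ∀ {k} {s : Vec ℕ k} → All (1 ≤_) s → Linked _<_ s → Linked _<_ (0 ∷ s)
  0∷ []        []  = [-]
  0∷ (1≤b ∷ _) s↗ = 1≤b ∷ s↗
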